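{- Let $v$ be a pattern (nonempty finite word over $\{0,1\}$) of length $|v|\geq 2$. Then for all integers $k\geq 1$ and all integers $d$ with $1\leq d<2^k$ we have $$A_v(d) \leq 2^{k+|v|-\nu_2(d)-1}.$$
   Context: $\mathbb{N}=\{0,1,2,\dots\}$. For a pattern $v\in\{0,1\}^+$, $e_v(n)$ is the number of (possibly overlapping) occurrences of $v$ in the binary expansion of $n\in\mathbb{N}$ (the expansion of $0$ is the empty word), with the convention that if $v$ begins with exactly $i\geq 1$ zeros and contains at least one $1$, then the binary expansion of $n$ is preceded by $i$ zeros before counting. For $n,d\in\mathbb{N}$, $d\geq 1$: $A_v(n,d)=\inf\{l\geq1: e_v(n+ld)\not\equiv e_v(n)\pmod 2\}$ and $A_v(d)=\sup_{n\in\mathbb{N}}A_v(n,d)$. $\nu_2(d)$ is the $2$-adic valuation of $d$. -}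

module Defs where

open import Data.Nat using (ℕ; zero; suc; _+_; _*_; _∸_; _^_; _≤_; _<_; _≟_)
open import Data.Nat.DivMod using (_/_; _%_)
open import Data.Bool using (Bool; true; false; if_then_else_; _∧_)
open import Data.List using (List; []; _∷_; _++_; reverse; replicate; length)
open import Data.Bool.ListAction using (any)
open import Data.Product using (∃; _×_)
open import Relation.Nullary using (¬_; does)
open import Relation.Binary.PropositionalEquality using (_≡_)

-- Binary digits of n, least significant first (fuel-based; fuel n suffices).
bitsRev : ℕ → ℕ → List Bool
bitsRev zero    _ = []
bitsRev (suc f) zero = []
bitsRev (suc f) n@(suc _) = does ((n % 2) ≟ 1) ∷ bitsRev f (n / 2)

-- Binary expansion of n, most significant digit first; bin 0 = [] (empty word).
-- true = 1, false = 0.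
bin : ℕ → List Bool
bin n = reverse (bitsRev n n)

leadingZeros : List Bool → ℕ
leadingZeros []          = 0
leadingZeros (true ∷ _)  = 0
leadingZeros (false ∷ w) = suc (leadingZeros w)

hasOne : List Bool → Bool
hasOne w = any (λ b → b) w

isPrefix : List Bool → List Bool → Bool
isPrefix []      _        = true
isPrefix (_ ∷ _) []       = false
isPrefix (a ∷ v) (b ∷ w)  = (if a then b else (if b then false else true)) ∧ isPrefix v w

occ : List Bool → List Bool → ℕ
occ v []        = if isPrefix v [] then 1 else 0
occ v w@(_ ∷ t) = (if isPrefix v w then 1 else 0) + occ v t

paddedBin : List Bool → ℕ → List Bool
paddedBin v n = if hasOne v then replicate (leadingZeros v) false ++ bin n else bin n

e : List Bool → ℕ → ℕ
e v n = occ v (paddedBin v n)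

-- 2-adic valuation (fuel-based; ν₂ 0 = 0 by convention, only used for d ≥ 1)
ν₂' : ℕ → ℕ → ℕ
ν₂' zero    _ = 0
ν₂' (suc f) zero = 0
ν₂' (suc f) n@(suc _) = if does ((n % 2) ≟ 0) then suc (ν₂' f (n / 2)) else 0

ν₂ : ℕ → ℕ
ν₂ n = ν₂' n n

-- A_v(n,d) ≤ B  (A_v(n,d) = inf{l ≥ 1 : e_v(n+ld) ≢ e_v(n) mod 2}, inf ∅ = ∞)
AvnLe : List Bool → ℕ → ℕ → ℕ → Set
AvnLe v n d B = ∃ λ l → 1 ≤ l × l ≤ B × ¬ (e v (n + l * d) % 2 ≡ e v n % 2)

-- A_v(d) ≤ B  (A_v(d) = sup over n of A_v(n,d))
AvLe : List Bool → ℕ → ℕ → Set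
AvLe v d B = ∀ n → AvnLe v n d B

{-# OPTIONS --safe #-}
-- Write d = m 2^ν with m odd, 2^κ ≤ m < 2^(κ+1), and r = n mod 2^ν. If
-- N = a 2^(κ+1+ν) + r, then N and N + d share the digits a, and the digits following a
-- start with 0 for N and with 1 for N + d. Since m is odd, the progression of
-- difference d starting at n meets such an N with any prescribed |v| - 1 low digits of
-- a within the first 2^(κ+|v|) terms. Compare the two choices "v without its last
-- digit" and "the same with its first digit flipped". Among the occurrences of v
-- that are not contained in a, only the one that begins at the flipped digit depends on the
-- choice, and it is present, for the first choice, in exactly one of N and N + d. So
-- e_v changes parity between N and N + d for one of the two choices.
-- The only failure is v = 0…0 with a = 0, where there are no leading zeros to
-- be counted; then n < 2^ν, and doubling l = 2^(|v|-1) adds a single occurrence.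
module Submission where

open import Defs
open import Data.Nat using (ℕ; _+_; _∸_; _^_; _≤_; _<_)
open import Data.Bool using (Bool)
open import Data.List using (List; length)
open import Data.Nat using (zero; suc; _*_; z≤n; s≤s; z<s; _≟_; NonZero)
open import Data.Nat.Properties
open import Data.Nat.DivMod
open import Data.Nat.Divisibility using (divides-refl)
open import Data.Nat.Tactic.RingSolver using (solve-∀)
open import Data.Bool using (true; false; if_then_else_; _∧_; not)
open import Data.Bool.Properties using (∧-zeroʳ; ∧-identityʳ)
open import Data.List using ([]; _∷_; _++_; _∷ʳ_; reverse; replicate)
open import Data.List.Properties
  using (++-assoc; length-++; length-reverse;
         reverse-++; reverse-involutive; unfold-reverse)
open import Data.Product using (∃; ∃₂; _×_; _,_)
open import Data.Sum using (_⊎_; inj₁; inj₂; [_,_]′)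
open import Function using (id)
open import Data.Empty using (⊥; ⊥-elim)
open import Relation.Nullary using (Dec; does; yes; no)
open import Relation.Binary.Definitions using (tri<; tri≈; tri>)
open import Relation.Binary.PropositionalEquality
  using (_≡_; refl; sym; trans; cong; cong₂; subst; subst₂; module ≡-Reasoning)

-- Binary digits

infix 6 _≈ᵇ_

-- The comparison inlined in isPrefix, which must unfold to it.
_≈ᵇ_ : Bool → Bool → Bool
a ≈ᵇ b = if a then b else (if b then false else true)

≈ᵇ-refl : ∀ a → (a ≈ᵇ a) ≡ true
≈ᵇ-refl true  = refl
≈ᵇ-refl false = refl

≈ᵇ-not : ∀ a → (a ≈ᵇ not a) ≡ false
≈ᵇ-not true  = refl
≈ᵇ-not false = refl

𝟙 : Bool → ℕ
𝟙 b = if b then 1 else 0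

odd : ℕ → Bool
odd n = does (n % 2 ≟ 1)

odd-digit : ∀ ε z → odd (𝟙 ε + z * 2) ≡ ε
odd-digit ε z = trans (cong (λ r → does (r ≟ 1)) ([m+kn]%n≡m%n (𝟙 ε) z 2)) (odd-𝟙 ε)
  where
  odd-𝟙 : ∀ ε → odd (𝟙 ε) ≡ ε
  odd-𝟙 true  = refl
  odd-𝟙 false = refl

half-digit : ∀ ε z → (𝟙 ε + z * 2) / 2 ≡ z
half-digit ε z = begin
  (𝟙 ε + z * 2) / 2      ≡⟨ +-distrib-/-∣ʳ (𝟙 ε) (divides-refl z) ⟩
  𝟙 ε / 2 + z * 2 / 2    ≡⟨ cong₂ _+_ (𝟙/2 ε) (m*n/n≡m z 2) ⟩
  z                      ∎
  where
  open ≡-Reasoning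
  𝟙/2 : ∀ ε → 𝟙 ε / 2 ≡ 0
  𝟙/2 true  = refl
  𝟙/2 false = refl

%2≡𝟙odd : ∀ n → n % 2 ≡ 𝟙 (odd n)
%2≡𝟙odd n with n % 2 | m%n<n n 2
... | 0 | _ = refl
... | 1 | _ = refl
... | suc (suc _) | s≤s (s≤s ())

digits : ∀ n → n ≡ 𝟙 (odd n) + n / 2 * 2
digits n = trans (m≡m%n+[m/n]*n n 2) (cong (_+ n / 2 * 2) (%2≡𝟙odd n))

bits : ℕ → List Bool
bits n = bitsRev n n

bitsRev-fuel : ∀ f g n → n ≤ f → n ≤ g → bitsRev f n ≡ bitsRev g n
bitsRev-fuel zero    zero    zero    _ _ = refl
bitsRev-fuel zero    (suc g) zero    _ _ = refl
bitsRev-fuel (suc f) zero    zero    _ _ = refl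
bitsRev-fuel (suc f) (suc g) zero    _ _ = refl
bitsRev-fuel (suc f) (suc g) (suc n) (s≤s n≤f) (s≤s n≤g) =
  cong (odd (suc n) ∷_) (bitsRev-fuel f g (suc n / 2) (≤-trans half≤ n≤f) (≤-trans half≤ n≤g))
  where
  half≤ : suc n / 2 ≤ n
  half≤ = ≤-pred (m/n<m (suc n) 2 (s≤s (s≤s z≤n)))

bits-pos : ∀ n → 0 < n → bits n ≡ odd n ∷ bits (n / 2)
bits-pos (suc n) _ = cong (odd (suc n) ∷_)
  (bitsRev-fuel n (suc n / 2) (suc n / 2) (≤-pred (m/n<m (suc n) 2 (s≤s (s≤s z≤n)))) ≤-refl)

-- Prefixes and occurrences

isPrefix-short : ∀ v t → length t < length v → isPrefix v t ≡ false
isPrefix-short (_ ∷ _) []      _       = refl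
isPrefix-short (a ∷ v) (b ∷ t) (s≤s l) rewrite isPrefix-short v t l = ∧-zeroʳ (a ≈ᵇ b)

isPrefix-++ : ∀ v t s → length v ≤ length t → isPrefix v (t ++ s) ≡ isPrefix v t
isPrefix-++ []      t       s _       = refl
isPrefix-++ (a ∷ v) (b ∷ t) s (s≤s l) = cong ((a ≈ᵇ b) ∧_) (isPrefix-++ v t s l)

isPrefix-refl : ∀ v → isPrefix v v ≡ true
isPrefix-refl []      = refl
isPrefix-refl (a ∷ v) rewrite ≈ᵇ-refl a = isPrefix-refl v

isPrefix⇒≡ : ∀ v t → length v ≡ length t → isPrefix v t ≡ true → v ≡ t
isPrefix⇒≡ []          []          _ _ = refl
isPrefix⇒≡ (true  ∷ v) (true  ∷ t) l p = cong (true ∷_) (isPrefix⇒≡ v t (suc-injective l) p)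
isPrefix⇒≡ (false ∷ v) (false ∷ t) l p = cong (false ∷_) (isPrefix⇒≡ v t (suc-injective l) p)

isSuffix : List Bool → List Bool → Bool
isSuffix v t = isPrefix (reverse v) (reverse t)

-- Between words of equal length, both tests amount to equality.
isPrefix≡isSuffix : ∀ v t → length v ≡ length t → isPrefix v t ≡ isSuffix v t
isPrefix≡isSuffix v t l with isPrefix v t in p | isSuffix v t in q
... | true  | true  = refl
... | false | false = refl
... | true  | false with refl ← isPrefix⇒≡ v t l p
  with () ← trans (sym q) (isPrefix-refl (reverse v))
... | false | true
  with r ← isPrefix⇒≡ (reverse v) (reverse t)
             (trans (length-reverse v) (trans l (sym (length-reverse t)))) q
  with refl ← trans (sym (reverse-involutive v)) (trans (cong reverse r) (reverse-involutive t))
  with () ← trans (sym p) (isPrefix-refl v)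

isSuffix-short : ∀ v t → length t < length v → isSuffix v t ≡ false
isSuffix-short v t l = isPrefix-short (reverse v) (reverse t)
  (subst₂ _<_ (sym (length-reverse t)) (sym (length-reverse v)) l)

isSuffix-∷ : ∀ v a t → length v ≤ length t → isSuffix v (a ∷ t) ≡ isSuffix v t
isSuffix-∷ v a t l rewrite unfold-reverse a t =
  isPrefix-++ (reverse v) (reverse t) (a ∷ [])
    (subst₂ _≤_ (sym (length-reverse v)) (sym (length-reverse t)) l)

length-∷ʳ : ∀ (t : List Bool) b → length (t ∷ʳ b) ≡ suc (length t)
length-∷ʳ t b = trans (length-++ t) (+-comm (length t) 1)

-- If v is shorter than `a ∷ t ∷ʳ b`, then `b` does not affect the prefix test, nor `a` the suffix
-- test. If the lengths agree, the only possible occurrence is the whole word, seen as a prefix on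
-- the left and as a suffix on the right. A longer v occurs nowhere.
isPrefix-isSuffix-exchange : ∀ v a t b →
  𝟙 (isPrefix v (a ∷ t ∷ʳ b)) + 𝟙 (isSuffix v (t ∷ʳ b)) ≡
  𝟙 (isPrefix v (a ∷ t)) + 𝟙 (isSuffix v (a ∷ t ∷ʳ b))
isPrefix-isSuffix-exchange v a t b with <-cmp (length v) (suc (suc (length t)))
... | tri< l _ _ = cong₂ (λ p q → 𝟙 p + 𝟙 q)
  (isPrefix-++ v (a ∷ t) (b ∷ []) (≤-pred l))
  (sym (isSuffix-∷ v a (t ∷ʳ b) (≤-trans (≤-pred l) (≤-reflexive (sym (length-∷ʳ t b))))))
... | tri≈ _ l _ = begin
  𝟙 (isPrefix v (a ∷ t ∷ʳ b)) + 𝟙 (isSuffix v (t ∷ʳ b))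
    ≡⟨ cong₂ (λ p q → 𝟙 p + 𝟙 q)
         (isPrefix≡isSuffix v (a ∷ t ∷ʳ b) (trans l (cong suc (sym (length-∷ʳ t b)))))
         (isSuffix-short v (t ∷ʳ b) (≤-reflexive (trans (cong suc (length-∷ʳ t b)) (sym l)))) ⟩
  𝟙 (isSuffix v (a ∷ t ∷ʳ b)) + 0
    ≡⟨ +-identityʳ _ ⟩
  𝟙 (isSuffix v (a ∷ t ∷ʳ b))
    ≡⟨ cong (λ p → 𝟙 p + 𝟙 (isSuffix v (a ∷ t ∷ʳ b)))
         (isPrefix-short v (a ∷ t) (≤-reflexive (sym l))) ⟨
  𝟙 (isPrefix v (a ∷ t)) + 𝟙 (isSuffix v (a ∷ t ∷ʳ b)) ∎
  where open ≡-Reasoning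
... | tri> _ _ l = cong₂ (λ p q → 𝟙 p + 𝟙 q)
  (trans (isPrefix-short v (a ∷ t ∷ʳ b) l′) (sym (isPrefix-short v (a ∷ t) (<-trans (n<1+n _) l))))
  (trans (isSuffix-short v (t ∷ʳ b) (<-trans (n<1+n _) l′)) (sym (isSuffix-short v (a ∷ t ∷ʳ b) l′)))
  where
  l′ : length (a ∷ t ∷ʳ b) < length v
  l′ = subst (λ k → suc k < length v) (sym (length-∷ʳ t b)) l

-- `occ` recurses from the first digit, whereas halving a number removes the last one; this is the
-- recursion from that end.
occ-∷ʳ : ∀ v t b → 0 < length v → occ v (t ∷ʳ b) ≡ 𝟙 (isSuffix v (t ∷ʳ b)) + occ v t
occ-∷ʳ (c ∷ [])    []      b _ = refl
occ-∷ʳ (c ∷ d ∷ v) []      b _ = cong (λ p → 𝟙 p + 0)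
  (trans (isPrefix-short (c ∷ d ∷ v) (b ∷ []) (s≤s (s≤s z≤n)))
         (sym (isSuffix-short (c ∷ d ∷ v) (b ∷ []) (s≤s (s≤s z≤n)))))
occ-∷ʳ v@(_ ∷ _)   (a ∷ t) b l = begin
  p + occ v (t ∷ʳ b)            ≡⟨ cong (p +_) (occ-∷ʳ v t b l) ⟩
  p + (s + occ v t)             ≡⟨ +-assoc p s (occ v t) ⟨
  p + s + occ v t               ≡⟨ cong (_+ occ v t) (isPrefix-isSuffix-exchange v a t b) ⟩
  p′ + s′ + occ v t             ≡⟨ cong (_+ occ v t) (+-comm p′ s′) ⟩
  s′ + p′ + occ v t             ≡⟨ +-assoc s′ p′ (occ v t) ⟩
  s′ + (p′ + occ v t)           ∎
  where
  open ≡-Reasoning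
  p p′ s s′ : ℕ
  p  = 𝟙 (isPrefix v (a ∷ t ∷ʳ b))
  p′ = 𝟙 (isPrefix v (a ∷ t))
  s  = 𝟙 (isSuffix v (t ∷ʳ b))
  s′ = 𝟙 (isSuffix v (a ∷ t ∷ʳ b))

-- Low-order digits

-- The pattern is read least significant digit first, and `x` counts as preceded by infinitely many
-- zeros.
matches : List Bool → ℕ → Bool
matches []      x = true
matches (b ∷ w) x = (b ≈ᵇ odd x) ∧ matches w (x / 2)

matches-digit : ∀ b w ε z → matches (b ∷ w) (𝟙 ε + z * 2) ≡ (b ≈ᵇ ε) ∧ matches w z
matches-digit b w ε z rewrite odd-digit ε z | half-digit ε z = refl

matches-zero : ∀ u s → matches (u ++ true ∷ s) 0 ≡ false
matches-zero []      s = refl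
matches-zero (b ∷ u) s rewrite matches-zero u s = ∧-zeroʳ (b ≈ᵇ false)

isPrefix-zeros-padded : ∀ j i x → j ≤ i →
  isPrefix (replicate j false) (bits x ++ replicate i false) ≡ matches (replicate j false) x
isPrefix-zeros-padded zero    i       x       _       = refl
isPrefix-zeros-padded (suc j) (suc i) zero    (s≤s l) = isPrefix-zeros-padded j i 0 l
isPrefix-zeros-padded (suc j) i       x@(suc _) l = trans
  (cong (λ t → isPrefix (replicate (suc j) false) (t ++ replicate i false)) (bits-pos x z<s))
  (cong ((false ≈ᵇ odd x) ∧_) (isPrefix-zeros-padded j i (x / 2) (<⇒≤ l)))

-- The 1 of the pattern has to meet a digit of `x`, after which only `i` zeros are left to compare;
-- so `i` padding zeros act like infinitely many.
isPrefix-padded : ∀ u i x → let w = u ++ true ∷ replicate i false in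
  isPrefix w (bits x ++ replicate i false) ≡ matches w x
isPrefix-padded u i zero =
  trans (isPrefix-short (u ++ true ∷ replicate i false) (replicate i false) short) (sym (matches-zero u _))
  where
  short : length (replicate i false) < length (u ++ true ∷ replicate i false)
  short rewrite length-++ u {true ∷ replicate i false} = m≤n+m _ (length u)
isPrefix-padded []      i x@(suc _) = trans
  (cong (λ t → isPrefix (true ∷ replicate i false) (t ++ replicate i false)) (bits-pos x z<s))
  (cong ((true ≈ᵇ odd x) ∧_) (isPrefix-zeros-padded i i (x / 2) ≤-refl))
isPrefix-padded (b ∷ u) i x@(suc _) = trans
  (cong (λ t → isPrefix (b ∷ u ++ true ∷ replicate i false) (t ++ replicate i false)) (bits-pos x z<s))
  (cong ((b ≈ᵇ odd x) ∧_) (isPrefix-padded u i (x / 2)))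

-- A run of zeros too long for the expansion of `x` meets its leading 1, so both tests fail.
isPrefix-zeros : ∀ j x → 0 < x → isPrefix (replicate j false) (bits x) ≡ matches (replicate j false) x
isPrefix-zeros zero    x             _ = refl
isPrefix-zeros (suc j) 1             _ = refl
isPrefix-zeros (suc j) x@(suc (suc _)) _ = trans
  (cong (isPrefix (replicate (suc j) false)) (bits-pos x z<s))
  (cong ((false ≈ᵇ odd x) ∧_) (isPrefix-zeros j (x / 2) (m≥n⇒m/n>0 {x} {2} (s≤s (s≤s z≤n)))))

replicate-∷ʳ : ∀ i → replicate i false ∷ʳ false ≡ replicate (suc i) false
replicate-∷ʳ zero    = refl
replicate-∷ʳ (suc i) = cong (false ∷_) (replicate-∷ʳ i)

reverse-replicate : ∀ i → reverse (replicate i false) ≡ replicate i false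
reverse-replicate zero    = refl
reverse-replicate (suc i) =
  trans (unfold-reverse false (replicate i false))
        (trans (cong (_∷ʳ false) (reverse-replicate i)) (replicate-∷ʳ i))

reverse-hasOne : ∀ v → hasOne v ≡ true → ∃ λ u → reverse v ≡ u ++ true ∷ replicate (leadingZeros v) false
reverse-hasOne (true  ∷ v) _ = reverse v , unfold-reverse true v
reverse-hasOne (false ∷ v) h with u , eq ← reverse-hasOne v h = u , (begin
  reverse (false ∷ v)                                  ≡⟨ unfold-reverse false v ⟩
  reverse v ∷ʳ false                                   ≡⟨ cong (_∷ʳ false) eq ⟩
  (u ++ true ∷ replicate i false) ∷ʳ false             ≡⟨ ++-assoc u _ _ ⟩
  u ++ true ∷ (replicate i false ∷ʳ false)             ≡⟨ cong (λ s → u ++ true ∷ s) (replicate-∷ʳ i) ⟩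
  u ++ true ∷ replicate (suc i) false                  ∎)
  where
  open ≡-Reasoning
  i = leadingZeros v

¬hasOne⇒zeros : ∀ v → hasOne v ≡ false → v ≡ replicate (length v) false
¬hasOne⇒zeros []          _ = refl
¬hasOne⇒zeros (false ∷ v) h = cong (false ∷_) (¬hasOne⇒zeros v h)

-- The numbers whose expansion, extended by zeros to the left, has the same
-- occurrences of v as the padded expansion.
Faithful : List Bool → ℕ → Set
Faithful v x = hasOne v ≡ true ⊎ 0 < x

isSuffix-paddedBin : ∀ v x → Faithful v x → isSuffix v (paddedBin v x) ≡ matches (reverse v) x
isSuffix-paddedBin v x f with hasOne v in h
isSuffix-paddedBin v x f | true with u , eq ← reverse-hasOne v h
  rewrite reverse-++ (replicate (leadingZeros v) false) (bin x)
        | reverse-involutive (bits x) | reverse-replicate (leadingZeros v) | eq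
  = isPrefix-padded u (leadingZeros v) x
isSuffix-paddedBin v x (inj₂ 0<x) | false
  rewrite reverse-involutive (bits x) | ¬hasOne⇒zeros v h | reverse-replicate (length v)
  = isPrefix-zeros (length v) x 0<x

paddedBin-∷ʳ : ∀ v x → 0 < x → paddedBin v x ≡ paddedBin v (x / 2) ∷ʳ odd x
paddedBin-∷ʳ v x 0<x with hasOne v
... | false = trans (cong reverse (bits-pos x 0<x)) (unfold-reverse (odd x) (bits (x / 2)))
... | true  = trans
  (cong (replicate (leadingZeros v) false ++_)
    (trans (cong reverse (bits-pos x 0<x)) (unfold-reverse (odd x) (bits (x / 2)))))
  (sym (++-assoc (replicate (leadingZeros v) false) _ _))

-- Dropping the last digit loses exactly the occurrence that ends there, if there is one.
e-half : ∀ v x → 0 < length v → Faithful v x → e v x ≡ 𝟙 (matches (reverse v) x) + e v (x / 2)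
-- Halving fixes 0, so the extra term has to vanish: the 1 in v matches no digit of 0.
e-half v zero    l (inj₁ h) with u , eq ← reverse-hasOne v h
  rewrite eq | matches-zero u (replicate (leadingZeros v) false) = refl
e-half v x@(suc _) l f = begin
  occ v (paddedBin v x)
    ≡⟨ cong (occ v) (paddedBin-∷ʳ v x z<s) ⟩
  occ v (paddedBin v (x / 2) ∷ʳ odd x)
    ≡⟨ occ-∷ʳ v (paddedBin v (x / 2)) (odd x) l ⟩
  𝟙 (isSuffix v (paddedBin v (x / 2) ∷ʳ odd x)) + e v (x / 2)
    ≡⟨ cong (λ t → 𝟙 (isSuffix v t) + e v (x / 2)) (paddedBin-∷ʳ v x z<s) ⟨
  𝟙 (isSuffix v (paddedBin v x)) + e v (x / 2)
    ≡⟨ cong (λ b → 𝟙 b + e v (x / 2)) (isSuffix-paddedBin v x f) ⟩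
  𝟙 (matches (reverse v) x) + e v (x / 2) ∎
  where open ≡-Reasoning

matches-+ : ∀ w c q → matches w (c + q * 2 ^ length w) ≡ matches w c
matches-+ []      c q = refl
matches-+ (b ∷ w) c q = begin
  matches (b ∷ w) (c + q * (2 * P))
    ≡⟨ cong (λ x → matches (b ∷ w) (x + q * (2 * P))) (digits c) ⟩
  matches (b ∷ w) (𝟙 (odd c) + c / 2 * 2 + q * (2 * P))
    ≡⟨ cong (matches (b ∷ w)) (regroup (𝟙 (odd c)) (c / 2) q P) ⟩
  matches (b ∷ w) (𝟙 (odd c) + (c / 2 + q * P) * 2)
    ≡⟨ matches-digit b w (odd c) (c / 2 + q * P) ⟩
  (b ≈ᵇ odd c) ∧ matches w (c / 2 + q * P)
    ≡⟨ cong ((b ≈ᵇ odd c) ∧_) (matches-+ w (c / 2) q) ⟩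
  matches (b ∷ w) c ∎
  where
  open ≡-Reasoning
  P = 2 ^ length w
  regroup : ∀ o h q P → o + h * 2 + q * (2 * P) ≡ o + (h + q * P) * 2
  regroup = solve-∀

val : List Bool → ℕ
val []      = 0
val (b ∷ w) = 𝟙 b + val w * 2

𝟙≤1 : ∀ b → 𝟙 b ≤ 1
𝟙≤1 true  = ≤-refl
𝟙≤1 false = z≤n

val< : ∀ w → val w < 2 ^ length w
val< []      = s≤s z≤n
val< (b ∷ w) = begin-strict
  𝟙 b + val w * 2        ≤⟨ +-monoˡ-≤ (val w * 2) (𝟙≤1 b) ⟩
  1 + val w * 2          <⟨ n<1+n _ ⟩
  suc (val w) * 2        ≤⟨ *-monoˡ-≤ 2 (val< w) ⟩
  2 ^ length w * 2       ≡⟨ *-comm (2 ^ length w) 2 ⟩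
  2 * 2 ^ length w       ∎
  where open ≤-Reasoning

-- The digits `w` match by construction, which leaves only the digit just above them.
matches-top : ∀ w z h → matches (w ∷ʳ z) (val w + h * 2 ^ length w) ≡ (z ≈ᵇ odd h)
matches-top []      z h rewrite *-identityʳ h = ∧-identityʳ (z ≈ᵇ odd h)
matches-top (b ∷ w) z h = begin
  matches (b ∷ w ∷ʳ z) (𝟙 b + val w * 2 + h * (2 * P))
    ≡⟨ cong (matches (b ∷ w ∷ʳ z)) (regroup (𝟙 b) (val w) h P) ⟩
  matches (b ∷ w ∷ʳ z) (𝟙 b + (val w + h * P) * 2)
    ≡⟨ matches-digit b (w ∷ʳ z) b (val w + h * P) ⟩
  (b ≈ᵇ b) ∧ matches (w ∷ʳ z) (val w + h * P)
    ≡⟨ cong₂ _∧_ (≈ᵇ-refl b) (matches-top w z h) ⟩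
  (z ≈ᵇ odd h) ∎
  where
  open ≡-Reasoning
  P = 2 ^ length w
  regroup : ∀ o h q P → o + h * 2 + q * (2 * P) ≡ o + (h + q * P) * 2
  regroup = solve-∀

matches-zeros : ∀ m → matches (replicate m false) 0 ≡ true
matches-zeros zero    = refl
matches-zeros (suc m) = matches-zeros m

Faithful-mono : ∀ v {x x′} → x ≤ x′ → Faithful v x → Faithful v x′
Faithful-mono v l (inj₁ h)   = inj₁ h
Faithful-mono v l (inj₂ 0<x) = inj₂ (≤-trans 0<x l)

-- Occurrences in numbers with prescribed low digits

module _ (v : List Bool) (y : Bool) (w : List Bool) (rev : reverse v ≡ y ∷ w) where

  private
    P : ℕ
    P = 2 ^ length w

    0<∣v∣ : 0 < length v
    0<∣v∣ = subst (0 <_) (trans (cong length (sym rev)) (length-reverse v)) z<s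

  e-digit : ∀ ε z → Faithful v (𝟙 ε + z * 2) → e v (𝟙 ε + z * 2) ≡ 𝟙 ((y ≈ᵇ ε) ∧ matches w z) + e v z
  e-digit ε z f = begin
    e v x                                       ≡⟨ e-half v x 0<∣v∣ f ⟩
    𝟙 (matches (reverse v) x) + e v (x / 2)     ≡⟨ cong₂ (λ u t → 𝟙 (matches u x) + e v t) rev (half-digit ε z) ⟩
    𝟙 (matches (y ∷ w) x) + e v z               ≡⟨ cong (λ b → 𝟙 b + e v z) (matches-digit y w ε z) ⟩
    𝟙 ((y ≈ᵇ ε) ∧ matches w z) + e v z          ∎
    where
    open ≡-Reasoning
    x = 𝟙 ε + z * 2

  -- The occurrences of v meeting the last j digits b of b + x * 2 ^ j depend on x
  -- only through its last |v| - 1 digits.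
  e-exchange : ∀ c q q′ → let x = c + q * P ; x′ = c + q′ * P in
    Faithful v x → Faithful v x′ → ∀ j b → b < 2 ^ j →
    e v (b + x * 2 ^ j) + e v x′ ≡ e v (b + x′ * 2 ^ j) + e v x
  e-exchange c q q′ f f′ zero zero _
    rewrite *-identityʳ (c + q * P) | *-identityʳ (c + q′ * P) = +-comm (e v (c + q * P)) _
  e-exchange c q q′ f f′ zero (suc b) (s≤s ())
  e-exchange c q q′ f f′ (suc j) b b< = begin
    e v (b + x * (2 * J)) + e v x′
      ≡⟨ cong (_+ e v x′) (peel q f) ⟩
    M + e v (b / 2 + x * J) + e v x′
      ≡⟨ +-assoc M _ _ ⟩
    M + (e v (b / 2 + x * J) + e v x′)
      ≡⟨ cong (M +_) (e-exchange c q q′ f f′ j (b / 2) half<) ⟩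
    M + (e v (b / 2 + x′ * J) + e v x)
      ≡⟨ +-assoc M _ _ ⟨
    M + e v (b / 2 + x′ * J) + e v x
      ≡⟨ cong (_+ e v x) (peel q′ f′) ⟨
    e v (b + x′ * (2 * J)) + e v x ∎
    where
    open ≡-Reasoning
    J = 2 ^ j
    x = c + q * P
    x′ = c + q′ * P
    -- An occurrence ending at the last digit of `b` reaches at most |v| - 1 digits into `x` or
    -- `x′`, where both agree with `c`; hence `M` serves for both.
    M = 𝟙 ((y ≈ᵇ odd b) ∧ matches w (b / 2 + c * J))
    half< : b / 2 < J
    half< = m<n*o⇒m/o<n (subst (b <_) (*-comm 2 J) b<)
    split : ∀ o h x J → o + h * 2 + x * (2 * J) ≡ o + (h + x * J) * 2
    split = solve-∀
    low : ∀ h c q P J → h + (c + q * P) * J ≡ h + c * J + q * J * P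
    low = solve-∀
    peel : ∀ t → Faithful v (c + t * P) →
      e v (b + (c + t * P) * (2 * J)) ≡ M + e v (b / 2 + (c + t * P) * J)
    peel t g = begin
      e v (b + X * (2 * J))
        ≡⟨ cong (e v) b+X*2J ⟩
      e v (𝟙 (odd b) + (b / 2 + X * J) * 2)
        ≡⟨ e-digit (odd b) (b / 2 + X * J) (Faithful-mono v X≤ g) ⟩
      𝟙 ((y ≈ᵇ odd b) ∧ matches w (b / 2 + X * J)) + e v (b / 2 + X * J)
        ≡⟨ cong (λ m → 𝟙 ((y ≈ᵇ odd b) ∧ m) + e v (b / 2 + X * J))
             (trans (cong (matches w) (low (b / 2) c t P J)) (matches-+ w (b / 2 + c * J) (t * J))) ⟩
      M + e v (b / 2 + X * J) ∎
      where
      X = c + t * P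
      b+X*2J : b + X * (2 * J) ≡ 𝟙 (odd b) + (b / 2 + X * J) * 2
      b+X*2J = trans (cong (_+ X * (2 * J)) (digits b)) (split (𝟙 (odd b)) (b / 2) X J)
      X≤ : X ≤ 𝟙 (odd b) + (b / 2 + X * J) * 2
      X≤ = ≤-trans (m≤m*n X (2 * J) {{m^n≢0 2 (suc j)}})
             (≤-trans (m≤n+m _ b) (≤-reflexive b+X*2J))

-- Parity

*2≢1+*2 : ∀ i j → i * 2 ≡ 1 + j * 2 → ⊥
*2≢1+*2 i j eq = even≢odd i j (trans (*-comm 2 i) (trans eq (cong suc (*-comm j 2))))

+-even : ∀ {m n} → m % 2 ≡ n % 2 → ∃ λ k → m + n ≡ k * 2
+-even {m} {n} eq = m / 2 + n / 2 + n % 2 , (begin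
  m + n
    ≡⟨ cong₂ _+_ (trans (m≡m%n+[m/n]*n m 2) (cong (_+ m / 2 * 2) eq)) (m≡m%n+[m/n]*n n 2) ⟩
  n % 2 + m / 2 * 2 + (n % 2 + n / 2 * 2)
    ≡⟨ regroup (n % 2) (m / 2) (n / 2) ⟩
  (m / 2 + n / 2 + n % 2) * 2 ∎)
  where
  open ≡-Reasoning
  regroup : ∀ r a b → r + a * 2 + (r + b * 2) ≡ (a + b + r) * 2
  regroup = solve-∀

suc-parity : ∀ m → suc m % 2 ≡ m % 2 → ⊥
suc-parity m eq with k , p ← +-even {suc m} {m} eq = *2≢1+*2 k m (trans (sym p) (double m))
  where
  double : ∀ m → suc m + m ≡ 1 + m * 2
  double = solve-∀

-- The sum of the two equations has an even left side and an odd right side. `A`, `B` will be the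
-- counts at N and N + d for one choice of digits, `A′`, `B′` those for the other, and `χ₀`, `χ₁`
-- mark the additional occurrence.
parity-clash : ∀ A B A′ B′ s t χ₀ χ₁ →
  A + t ≡ A′ + (χ₀ + s) → B + t ≡ B′ + (χ₁ + s) → χ₀ + χ₁ ≡ 1 →
  A % 2 ≡ B % 2 → A′ % 2 ≡ B′ % 2 → ⊥
parity-clash A B A′ B′ s t χ₀ χ₁ eqA eqB χ AB A′B′
  with k , p ← +-even {A} {B} AB | k′ , p′ ← +-even {A′} {B′} A′B′ =
  *2≢1+*2 (k + t) (k′ + s) (begin
    (k + t) * 2                            ≡⟨ *-distribʳ-+ 2 k t ⟩
    k * 2 + t * 2                          ≡⟨ cong (_+ t * 2) p ⟨
    A + B + t * 2                          ≡⟨ left A B t ⟩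
    (A + t) + (B + t)                      ≡⟨ cong₂ _+_ eqA eqB ⟩
    (A′ + (χ₀ + s)) + (B′ + (χ₁ + s))      ≡⟨ right A′ B′ χ₀ χ₁ s ⟩
    (χ₀ + χ₁) + ((A′ + B′) + s * 2)        ≡⟨ cong₂ (λ i j → i + (j + s * 2)) χ p′ ⟩
    1 + (k′ * 2 + s * 2)                   ≡⟨ cong suc (*-distribʳ-+ 2 k′ s) ⟨
    1 + (k′ + s) * 2                       ∎)
  where
  open ≡-Reasoning
  left : ∀ A B t → A + B + t * 2 ≡ (A + t) + (B + t)
  left = solve-∀
  right : ∀ A B i j s → (A + (i + s)) + (B + (j + s)) ≡ (i + j) + ((A + B) + s * 2)
  right = solve-∀

-- Arithmetic progressions modulo powers of two

-- Adding the odd `d` once flips the parity, so `ε` records whether a flip is wanted.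
adjust-parity : ∀ n d x → odd d ≡ true → ∃₂ λ ε n′ → n + 𝟙 ε * d ≡ 𝟙 (odd x) + n′ * 2
adjust-parity n d x od with odd n in on | odd x
... | true  | true  = false , n / 2 , trans (+-identityʳ n)
                        (trans (digits n) (cong (λ b → 𝟙 b + n / 2 * 2) on))
... | false | false = false , n / 2 , trans (+-identityʳ n)
                        (trans (digits n) (cong (λ b → 𝟙 b + n / 2 * 2) on))
... | true  | false = true , n / 2 + d / 2 + 1 , (begin
  n + 1 * d
    ≡⟨ cong₂ (λ i j → i + 1 * j) (digits n) (digits d) ⟩
  𝟙 (odd n) + n / 2 * 2 + 1 * (𝟙 (odd d) + d / 2 * 2)
    ≡⟨ cong₂ (λ i j → 𝟙 i + n / 2 * 2 + 1 * (𝟙 j + d / 2 * 2)) on od ⟩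
  1 + n / 2 * 2 + 1 * (1 + d / 2 * 2)
    ≡⟨ carry (n / 2) (d / 2) ⟩
  (n / 2 + d / 2 + 1) * 2 ∎)
  where
  open ≡-Reasoning
  carry : ∀ a b → 1 + a * 2 + 1 * (1 + b * 2) ≡ (a + b + 1) * 2
  carry = solve-∀
... | false | true  = true , n / 2 + d / 2 , (begin
  n + 1 * d
    ≡⟨ cong₂ (λ i j → i + 1 * j) (digits n) (digits d) ⟩
  𝟙 (odd n) + n / 2 * 2 + 1 * (𝟙 (odd d) + d / 2 * 2)
    ≡⟨ cong₂ (λ i j → 𝟙 i + n / 2 * 2 + 1 * (𝟙 j + d / 2 * 2)) on od ⟩
  n / 2 * 2 + 1 * (1 + d / 2 * 2)
    ≡⟨ carry (n / 2) (d / 2) ⟩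
  1 + (n / 2 + d / 2) * 2 ∎)
  where
  open ≡-Reasoning
  carry : ∀ a b → a * 2 + 1 * (1 + b * 2) ≡ 1 + (a + b) * 2
  carry = solve-∀

-- The digits of `l` are found from the lowest up. Once `ε` makes the last digits agree, removing
-- them turns the terms with l ≡ ε mod 2 into a progression from `n′` with the same difference.
hits-residue : ∀ p n d x → odd d ≡ true → x < 2 ^ p →
  ∃₂ λ l q → l < 2 ^ p × n + l * d ≡ x + q * 2 ^ p
hits-residue zero    n d zero    od _ = 0 , n , s≤s z≤n , trans (+-identityʳ n) (sym (*-identityʳ n))
hits-residue zero    n d (suc x) od (s≤s ())
hits-residue (suc p) n d x       od x<
  with ε , n′ , eq ← adjust-parity n d x od
  with l , q , l< , eq′ ← hits-residue p n′ d (x / 2) od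
         (m<n*o⇒m/o<n (subst (x <_) (*-comm 2 (2 ^ p)) x<)) =
  𝟙 ε + l * 2 , q , bound , (begin
  n + (𝟙 ε + l * 2) * d                   ≡⟨ regroup n (𝟙 ε) l d ⟩
  (n + 𝟙 ε * d) + l * d * 2               ≡⟨ cong (_+ l * d * 2) eq ⟩
  𝟙 (odd x) + n′ * 2 + l * d * 2          ≡⟨ factor (𝟙 (odd x)) n′ (l * d) ⟩
  𝟙 (odd x) + (n′ + l * d) * 2            ≡⟨ cong (λ t → 𝟙 (odd x) + t * 2) eq′ ⟩
  𝟙 (odd x) + (x / 2 + q * 2 ^ p) * 2     ≡⟨ expand (𝟙 (odd x)) (x / 2) q (2 ^ p) ⟩
  (𝟙 (odd x) + x / 2 * 2) + q * 2 ^ suc p ≡⟨ cong (_+ q * 2 ^ suc p) (digits x) ⟨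
  x + q * 2 ^ suc p                       ∎)
  where
  open ≡-Reasoning
  regroup : ∀ n i l d → n + (i + l * 2) * d ≡ (n + i * d) + l * d * 2
  regroup = solve-∀
  factor : ∀ o a b → o + a * 2 + b * 2 ≡ o + (a + b) * 2
  factor = solve-∀
  expand : ∀ o h q P → o + (h + q * P) * 2 ≡ (o + h * 2) + q * (2 * P)
  expand = solve-∀
  bound : 𝟙 ε + l * 2 < 2 ^ suc p
  bound = ≤-trans (s≤s (+-monoˡ-≤ (l * 2) (𝟙≤1 ε)))
            (≤-trans (*-monoˡ-≤ 2 l<) (≤-reflexive (*-comm (2 ^ p) 2)))

-- Odd part and leading power of two

n%2≢0⇒odd : ∀ n r → n % 2 ≡ suc r → odd n ≡ true
n%2≢0⇒odd n zero    eq = cong (λ t → does (t ≟ 1)) eq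
n%2≢0⇒odd n (suc r) eq with s≤s (s≤s ()) ← subst (_< 2) eq (m%n<n n 2)

n%2≡0⇒n≡half*2 : ∀ n → n % 2 ≡ 0 → n ≡ n / 2 * 2
n%2≡0⇒n≡half*2 n eq = trans (m≡m%n+[m/n]*n n 2) (cong (_+ n / 2 * 2) eq)

ν₂′-factor : ∀ f n → 0 < n → n ≤ f → ∃ λ m → odd m ≡ true × n ≡ m * 2 ^ ν₂' f n
ν₂′-factor (suc f) n@(suc n-1) _ (s≤s n-1≤f) with n % 2 in eq
... | suc r = n , n%2≢0⇒odd n r eq , sym (*-identityʳ n)
... | zero with m , om , eq′ ← ν₂′-factor f (n / 2)
                  (n≢0⇒n>0 λ h → 1+n≢0 (trans (n%2≡0⇒n≡half*2 n eq) (cong (_* 2) h)))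
                  (≤-trans (≤-pred (m/n<m n 2 (s≤s (s≤s z≤n)))) n-1≤f) =
  m , om , (begin
    n                             ≡⟨ n%2≡0⇒n≡half*2 n eq ⟩
    n / 2 * 2                     ≡⟨ cong (_* 2) eq′ ⟩
    m * 2 ^ ν₂' f (n / 2) * 2     ≡⟨ regroup m (2 ^ ν₂' f (n / 2)) ⟩
    m * (2 * 2 ^ ν₂' f (n / 2))   ∎)
  where
  open ≡-Reasoning
  regroup : ∀ m P → m * P * 2 ≡ m * (2 * P)
  regroup = solve-∀

-- In passing to the next number, the exponent grows exactly when that number is 2^(κ+1).
dyadic-bounds : ∀ n → 0 < n → ∃ λ κ → 2 ^ κ ≤ n × n < 2 ^ suc κ
dyadic-bounds 1 _ = 0 , s≤s z≤n , s≤s (s≤s z≤n)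
dyadic-bounds (suc n@(suc _)) _ with κ , lo , hi ← dyadic-bounds n z<s
  with <-cmp (suc n) (2 ^ suc κ)
... | tri< l _ _ = κ , m≤n⇒m≤1+n lo , l
... | tri≈ _ q _ = suc κ , ≤-reflexive (sym q) , subst (_< 2 ^ suc (suc κ)) (sym q)
                     (^-monoʳ-< 2 (s≤s (s≤s z≤n)) (n<1+n (suc κ)))
... | tri> _ _ l = ⊥-elim (<⇒≱ l hi)

-- Forcing a change of parity along the progression

module _ (v : List Bool) (y : Bool) (w : List Bool) (z : Bool) (rev : reverse v ≡ y ∷ w ∷ʳ z)
         (m κ ν r n′ : ℕ) (odd-m : odd m ≡ true) (2^κ≤m : 2 ^ κ ≤ m) (m<2^1+κ : m < 2 ^ suc κ)
         (r<2^ν : r < 2 ^ ν) where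

  private
    -- The last digit of v is `y`, the first is `z`, and `p` is |v| - 1. Cutting at 2^ν leaves the
    -- remainder `r` fixed along the progression, while `n′` advances by the odd `m`.
    p d n L K V P : ℕ
    p = length (w ∷ʳ z)
    d = m * 2 ^ ν
    n = r + n′ * 2 ^ ν
    L = 2 ^ (suc κ + p)
    K = 2 ^ κ
    V = 2 ^ ν
    P = 2 ^ length w

    2^p≡2P : 2 ^ p ≡ 2 * P
    2^p≡2P = cong (2 ^_) (length-∷ʳ w z)

  -- If no `l` up to `L` is a witness, all these terms have the parity of the starting one; the case
  -- l = 0, which cannot be a witness, is included.
  change-or-same : ∀ l → l ≤ L → AvnLe v n d L ⊎ e v (n + l * d) % 2 ≡ e v n % 2
  change-or-same zero    _  = inj₂ (cong (λ t → e v t % 2) (+-identityʳ n))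
  change-or-same (suc l) l≤ with e v (n + suc l * d) % 2 ≟ e v n % 2
  ... | yes same = inj₂ same
  ... | no  diff = inj₁ (suc l , s≤s z≤n , l≤ , diff)

  -- For v = 0…0, going from l = 2 ^ (|v| - 1) to l = 2 ^ |v| lengthens by one a
  -- block of at least |v| - 1 zeros.
  change-zeros : hasOne v ≡ false → n′ ≡ 0 → AvnLe v n d L
  change-zeros h refl
    with change-or-same (2 ^ p) (^-monoʳ-≤ 2 (m≤n+m p (suc κ)))
       | change-or-same (2 ^ suc p) (^-monoʳ-≤ 2 (s≤s (m≤n+m p κ)))
  ... | inj₁ c | _      = c
  ... | _      | inj₁ c = c
  ... | inj₂ s | inj₂ s′ = ⊥-elim (suc-parity (e v (n + 2 ^ p * d))
          (trans (cong (_% 2) (sym one-more)) (trans s′ (sym s))))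
    where
    open ≡-Reasoning
    Q = 2 ^ p
    0<m : 0 < m
    0<m = ≤-trans (m^n>0 2 κ) 2^κ≤m
    pos : ∀ i → 0 < i → 0 < i * Q
    pos i 0<i = *-mono-≤ 0<i (m^n>0 2 p)
    -- The product `m * Q` ends in |v| - 1 zeros, so its double ends in |v| zeros, one further
    -- occurrence of v.
    top : (y ≈ᵇ false) ∧ matches (w ∷ʳ z) (m * Q) ≡ true
    top = begin
      (y ≈ᵇ false) ∧ matches (w ∷ʳ z) (m * Q)   ≡⟨ cong ((y ≈ᵇ false) ∧_) (matches-+ (w ∷ʳ z) 0 m) ⟩
      matches (y ∷ w ∷ʳ z) 0                    ≡⟨ cong (λ u → matches u 0) rev ⟨
      matches (reverse v) 0                     ≡⟨ cong (λ u → matches (reverse u) 0) (¬hasOne⇒zeros v h) ⟩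
      matches (reverse (replicate (length v) false)) 0
        ≡⟨ cong (λ u → matches u 0) (reverse-replicate (length v)) ⟩
      matches (replicate (length v) false) 0    ≡⟨ matches-zeros (length v) ⟩
      true                                      ∎
    e-double : e v (m * 2 * Q) ≡ 1 + e v (m * Q)
    e-double = begin
      e v (m * 2 * Q)    ≡⟨ cong (e v) (swap m Q) ⟩
      e v (m * Q * 2)    ≡⟨ e-digit v y (w ∷ʳ z) rev false (m * Q)
                              (inj₂ (*-mono-≤ (pos m 0<m) (s≤s {n = 1} z≤n))) ⟩
      𝟙 ((y ≈ᵇ false) ∧ matches (w ∷ʳ z) (m * Q)) + e v (m * Q)
                         ≡⟨ cong (λ b → 𝟙 b + e v (m * Q)) top ⟩
      1 + e v (m * Q)    ∎
      where
      swap : ∀ m Q → m * 2 * Q ≡ m * Q * 2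
      swap = solve-∀
    at₁ : ∀ r m Q V → r + 0 * V + Q * (m * V) ≡ r + m * Q * V
    at₁ = solve-∀
    at₂ : ∀ r m Q V → r + 0 * V + 2 * Q * (m * V) ≡ r + m * 2 * Q * V
    at₂ = solve-∀
    -- Both terms end in the `ν` digits of `r`, preceded by at least |v| - 1 zeros, so the
    -- occurrences meeting `r` cancel.
    one-more : e v (n + 2 ^ suc p * d) ≡ suc (e v (n + 2 ^ p * d))
    one-more = +-cancelʳ-≡ (e v (m * Q)) _ _ (begin
      e v (r + 0 * V + 2 * Q * (m * V)) + e v (m * Q)
        ≡⟨ cong (λ t → e v t + e v (m * Q)) (at₂ r m Q V) ⟩
      e v (r + m * 2 * Q * V) + e v (m * Q)
        ≡⟨ e-exchange v y (w ∷ʳ z) rev 0 (m * 2) m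
             (inj₂ (pos (m * 2) (*-mono-≤ 0<m (s≤s {n = 1} z≤n)))) (inj₂ (pos m 0<m)) ν r r<2^ν ⟩
      e v (r + m * Q * V) + e v (m * 2 * Q)
        ≡⟨ cong₂ (λ t u → e v t + u) (sym (at₁ r m Q V)) e-double ⟩
      e v (n + 2 ^ p * d) + (1 + e v (m * Q))
        ≡⟨ +-suc _ _ ⟩
      suc (e v (n + 2 ^ p * d)) + e v (m * Q) ∎)

  -- From the low end: the digits of v without its last and first ones, then ζ in
  -- place of the first one, then q.
  above : Bool → ℕ → ℕ
  above ζ q = val w + (𝟙 ζ + q * 2) * P

  private
    L≡ : L ≡ 2 * P * 2 ^ suc κ
    L≡ = trans (^-distribˡ-+-* 2 (suc κ) p)
            (trans (*-comm (2 ^ suc κ) (2 ^ p)) (cong (_* 2 ^ suc κ) 2^p≡2P))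

    above<L : ∀ ζ → (val w + 𝟙 ζ * P) * 2 ^ suc κ < L
    above<L ζ = subst ((val w + 𝟙 ζ * P) * 2 ^ suc κ <_) (sym L≡)
      (*-monoˡ-< (2 ^ suc κ) {{m^n≢0 2 (suc κ)}}
        (+-mono-<-≤ (val< w) (*-monoˡ-≤ P (𝟙≤1 ζ))))

  -- The residue prescribed consists of `κ` + 1 zeros, which leave room to add `m` without a carry,
  -- below the `p` digits of `w` and `ζ`.
  reach : ∀ ζ → ∃₂ λ l q → l < L × n′ + l * m ≡ above ζ q * 2 ^ suc κ
  reach ζ =
    let l , q , l< , eq = hits-residue (suc κ + p) n′ m ((val w + 𝟙 ζ * P) * 2 ^ suc κ) odd-m (above<L ζ) in
    l , q , l< , trans eq
      (trans (cong (λ t → (val w + 𝟙 ζ * P) * 2 ^ suc κ + q * t) L≡) (regroup (val w) (𝟙 ζ) q P (2 ^ suc κ)))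
    where
    regroup : ∀ c i q P X → (c + i * P) * X + q * (2 * P * X) ≡ (c + (i + q * 2) * P) * X
    regroup = solve-∀

  private
    -- `δ` is `m` without its leading 1, and `j` is the position of that 1 in `d`.
    δ j : ℕ
    δ = m ∸ K
    j = κ + ν

    m≡K+δ : m ≡ K + δ
    m≡K+δ = sym (m+[n∸m]≡n 2^κ≤m)

    δ<K : δ < K
    δ<K = +-cancelˡ-< K δ K (subst₂ _<_ m≡K+δ (cong (K +_) (+-identityʳ K)) m<2^1+κ)

    2^j : 2 ^ j ≡ K * V
    2^j = ^-distribˡ-+-* 2 κ ν

    r<2^j : r < 2 ^ j
    r<2^j = ≤-trans r<2^ν (^-monoʳ-≤ 2 (m≤n+m ν κ))

    r+δV<2^j : r + δ * V < 2 ^ j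
    r+δV<2^j = subst (r + δ * V <_) (sym 2^j)
      (≤-trans (+-monoˡ-< (δ * V) r<2^ν) (*-monoˡ-≤ V δ<K))

    -- The topmost of the `κ` + 1 zeros is the digit at position `j`, directly below `a`.
    lower : ∀ l a → n′ + l * m ≡ a * 2 ^ suc κ → n + l * d ≡ r + a * 2 * 2 ^ j
    lower l a eq = begin
      r + n′ * V + l * (m * V)     ≡⟨ collect r n′ l m V ⟩
      r + (n′ + l * m) * V         ≡⟨ cong (λ t → r + t * V) eq ⟩
      r + a * (2 * K) * V          ≡⟨ spread r a K V ⟩
      r + a * 2 * (K * V)          ≡⟨ cong (λ t → r + a * 2 * t) 2^j ⟨
      r + a * 2 * 2 ^ j            ∎
      where
      open ≡-Reasoning
      collect : ∀ r n l m V → r + n * V + l * (m * V) ≡ r + (n + l * m) * V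
      collect = solve-∀
      spread : ∀ r a K V → r + a * (2 * K) * V ≡ r + a * 2 * (K * V)
      spread = solve-∀

    -- Adding `d` turns the 0 at position `j` into 1; the rest of `d` stays below 2^j together with
    -- `r`, so nothing carries into `a`.
    upper : ∀ l a → n′ + l * m ≡ a * 2 ^ suc κ → n + suc l * d ≡ r + δ * V + (1 + a * 2) * 2 ^ j
    upper l a eq = begin
      n + (d + l * d)                            ≡⟨ rotate n d (l * d) ⟩
      (n + l * d) + d                            ≡⟨ cong₂ (λ s t → s + t * V) (lower l a eq) m≡K+δ ⟩
      r + a * 2 * 2 ^ j + (K + δ) * V            ≡⟨ cong (λ t → r + a * 2 * t + (K + δ) * V) 2^j ⟩
      r + a * 2 * (K * V) + (K + δ) * V          ≡⟨ collect r a K V δ ⟩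
      r + δ * V + (1 + a * 2) * (K * V)          ≡⟨ cong (λ t → r + δ * V + (1 + a * 2) * t) 2^j ⟨
      r + δ * V + (1 + a * 2) * 2 ^ j            ∎
      where
      open ≡-Reasoning
      rotate : ∀ n d t → n + (d + t) ≡ n + t + d
      rotate = solve-∀
      collect : ∀ r a K V D → r + a * 2 * (K * V) + (K + D) * V ≡ r + D * V + (1 + a * 2) * (K * V)
      collect = solve-∀

    -- The form required by `e-exchange`: the last `p` digits depend on neither `ζ` nor `q`.
    above-digit : ∀ ζ q ε → 𝟙 ε + above ζ q * 2 ≡ 𝟙 ε + val w * 2 + (𝟙 ζ + q * 2) * 2 ^ p
    above-digit ζ q ε = trans (regroup (𝟙 ε) (val w) (𝟙 ζ + q * 2) P)
                          (cong (λ t → 𝟙 ε + val w * 2 + (𝟙 ζ + q * 2) * t) (sym 2^p≡2P))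
      where
      regroup : ∀ i c h P → i + (c + h * P) * 2 ≡ i + c * 2 + h * (2 * P)
      regroup = solve-∀

    faithful-digit : ∀ ζ q ε → Faithful v (above ζ q) → Faithful v (𝟙 ε + above ζ q * 2)
    faithful-digit ζ q ε = Faithful-mono v (≤-trans (m≤m*n (above ζ q) 2) (m≤n+m _ (𝟙 ε)))

    faithful-above : ∀ ζ l q → n′ + l * m ≡ above ζ q * 2 ^ suc κ → Faithful v n′ → Faithful v (above ζ q)
    faithful-above ζ l q eq (inj₁ h)    = inj₁ h
    faithful-above ζ l q eq (inj₂ 0<n′) = inj₂ (n≢0⇒n>0 λ a≡0 →
      <⇒≢ (≤-trans 0<n′ (m≤m+n n′ (l * m))) (sym (trans eq (cong (_* 2 ^ suc κ) a≡0))))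

    exchange-above : ∀ ζ ζ′ q q′ → Faithful v (above ζ q) → Faithful v (above ζ′ q′) →
      ∀ ε b → b < 2 ^ j →
      e v (b + (𝟙 ε + above ζ q * 2) * 2 ^ j) + e v (𝟙 ε + above ζ′ q′ * 2) ≡
      e v (b + (𝟙 ε + above ζ′ q′ * 2) * 2 ^ j) + e v (𝟙 ε + above ζ q * 2)
    exchange-above ζ ζ′ q q′ f f′ ε b b<
      with g ← faithful-digit ζ q ε f | g′ ← faithful-digit ζ′ q′ ε f′
      rewrite above-digit ζ q ε | above-digit ζ′ q′ ε =
      e-exchange v y (w ∷ʳ z) rev (𝟙 ε + val w * 2) (𝟙 ζ + q * 2) (𝟙 ζ′ + q′ * 2) g g′ j b b<

    -- An occurrence of v ending at `ε` begins at `ζ`, and its inner digits match by construction.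
    e-above : ∀ ζ q ε → Faithful v (above ζ q) →
      e v (𝟙 ε + above ζ q * 2) ≡ 𝟙 ((y ≈ᵇ ε) ∧ (z ≈ᵇ ζ)) + e v (above ζ q)
    e-above ζ q ε f = trans
      (e-digit v y (w ∷ʳ z) rev ε (above ζ q) (faithful-digit ζ q ε f))
      (cong (λ b → 𝟙 ((y ≈ᵇ ε) ∧ b) + e v (above ζ q))
        (trans (matches-top w z (𝟙 ζ + q * 2)) (cong (z ≈ᵇ_) (odd-digit ζ q))))

    e-above-not : ∀ q ε → Faithful v (above (not z) q) →
      e v (𝟙 ε + above (not z) q * 2) ≡ e v (above (not z) q)
    e-above-not q ε f = trans (e-above (not z) q ε f)
      (cong (λ b → 𝟙 b + e v (above (not z) q))
        (trans (cong ((y ≈ᵇ ε) ∧_) (≈ᵇ-not z)) (∧-zeroʳ (y ≈ᵇ ε))))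

    -- The digit at position `j` is 0 in N and 1 in N + d, and `y` equals exactly one of these.
    one-digit : ∀ y z → 𝟙 ((y ≈ᵇ false) ∧ (z ≈ᵇ z)) + 𝟙 ((y ≈ᵇ true) ∧ (z ≈ᵇ z)) ≡ 1
    one-digit true  z rewrite ≈ᵇ-refl z = refl
    one-digit false z rewrite ≈ᵇ-refl z = refl

  not-all-same : Faithful v n′ → ∀ l q l′ q′ →
    n′ + l * m ≡ above z q * 2 ^ suc κ → n′ + l′ * m ≡ above (not z) q′ * 2 ^ suc κ →
    e v (n + l * d) % 2 ≡ e v (n + suc l * d) % 2 →
    e v (n + l′ * d) % 2 ≡ e v (n + suc l′ * d) % 2 → ⊥
  not-all-same f l q l′ q′ eq eq′ = parity-clash
    (e v (n + l * d)) (e v (n + suc l * d)) (e v (n + l′ * d)) (e v (n + suc l′ * d))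
    (e v a) (e v a′) (𝟙 ((y ≈ᵇ false) ∧ (z ≈ᵇ z))) (𝟙 ((y ≈ᵇ true) ∧ (z ≈ᵇ z)))
    eqA eqB (one-digit y z)
    where
    open ≡-Reasoning
    a a′ : ℕ
    a  = above z q
    a′ = above (not z) q′
    g : Faithful v a
    g = faithful-above z l q eq f
    g′ : Faithful v a′
    g′ = faithful-above (not z) l′ q′ eq′ f
    -- The two choices are compared at N here, and at N + d in `eqB`. The low parts agree, so the
    -- counts differ only by the occurrences inside `a` or `a′` and the one beginning at `z`.
    eqA : e v (n + l * d) + e v a′ ≡ e v (n + l′ * d) + (𝟙 ((y ≈ᵇ false) ∧ (z ≈ᵇ z)) + e v a)
    eqA = begin
      e v (n + l * d) + e v a′
        ≡⟨ cong₂ (λ s t → e v s + t) (lower l a eq) (sym (e-above-not q′ false g′)) ⟩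
      e v (r + a * 2 * 2 ^ j) + e v (a′ * 2)
        ≡⟨ exchange-above z (not z) q q′ g g′ false r r<2^j ⟩
      e v (r + a′ * 2 * 2 ^ j) + e v (a * 2)
        ≡⟨ cong₂ (λ s t → e v s + t) (sym (lower l′ a′ eq′)) (e-above z q false g) ⟩
      e v (n + l′ * d) + (𝟙 ((y ≈ᵇ false) ∧ (z ≈ᵇ z)) + e v a) ∎
    eqB : e v (n + suc l * d) + e v a′ ≡ e v (n + suc l′ * d) + (𝟙 ((y ≈ᵇ true) ∧ (z ≈ᵇ z)) + e v a)
    eqB = begin
      e v (n + suc l * d) + e v a′
        ≡⟨ cong₂ (λ s t → e v s + t) (upper l a eq) (sym (e-above-not q′ true g′)) ⟩
      e v (r + δ * V + (1 + a * 2) * 2 ^ j) + e v (1 + a′ * 2)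
        ≡⟨ exchange-above z (not z) q q′ g g′ true (r + δ * V) r+δV<2^j ⟩
      e v (r + δ * V + (1 + a′ * 2) * 2 ^ j) + e v (1 + a * 2)
        ≡⟨ cong₂ (λ s t → e v s + t) (sym (upper l′ a′ eq′)) (e-above z q true g) ⟩
      e v (n + suc l′ * d) + (𝟙 ((y ≈ᵇ true) ∧ (z ≈ᵇ z)) + e v a) ∎

  change-faithful : Faithful v n′ → AvnLe v n d L
  change-faithful f =
    let l  , q  , l<  , eq  = reach z
        l′ , q′ , l′< , eq′ = reach (not z)
    -- Either one of the four terms gives a witness, or all four have the parity of the start. Since
    -- `l` and `l′` are below `L`, their successors are still admissible.
    in [ id , (λ s₁ → [ id , (λ s₂ → [ id , (λ s₃ → [ id , (λ s₄ →
         ⊥-elim (not-all-same f l q l′ q′ eq eq′ (trans s₁ (sym s₂)) (trans s₃ (sym s₄))))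
       ]′ (change-or-same (suc l′) l′<))
       ]′ (change-or-same l′ (<⇒≤ l′<)))
       ]′ (change-or-same (suc l) l<))
       ]′ (change-or-same l (<⇒≤ l<))

  change : AvnLe v n d L
  change = by-cases (hasOne v) refl (n′ ≟ 0)
    where
    by-cases : ∀ b → hasOne v ≡ b → Dec (n′ ≡ 0) → AvnLe v n d L
    by-cases true  h _           = change-faithful (inj₁ h)
    by-cases false h (yes n′≡0)  = change-zeros h n′≡0
    by-cases false h (no n′≢0)   = change-faithful (inj₂ (n≢0⇒n>0 n′≢0))

-- From the odd part of d to the stated exponent

reverse-ends : ∀ v → 2 ≤ length v → ∃₂ λ y w → ∃ λ z → reverse v ≡ y ∷ w ∷ʳ z
reverse-ends (z ∷ [])        (s≤s ())
reverse-ends (z ∷ v@(_ ∷ _)) _ with reverse v in eq | length-reverse {A = Bool} v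
... | []    | ()
... | y ∷ w | _ = y , w , z , trans (unfold-reverse z v) (cong (_∷ʳ z) eq)

AvnLe-mono : ∀ v n d {B B′} → B ≤ B′ → AvnLe v n d B → AvnLe v n d B′
AvnLe-mono v n d le (l , 1≤l , l≤ , ne) = l , 1≤l , ≤-trans l≤ le , ne

theorem1p8 : (v : List Bool) → 2 ≤ length v →
    (k d : ℕ) → 1 ≤ k → 1 ≤ d → d < 2 ^ k →
    AvLe v d (2 ^ (k + length v ∸ ν₂ d ∸ 1))
theorem1p8 v 2≤∣v∣ k d 1≤k 1≤d d<2^k n
  with y , w , z , rev ← reverse-ends v 2≤∣v∣
  with m , odd-m , d≡ ← ν₂′-factor d d 1≤d ≤-refl
  with κ , 2^κ≤m , m<2^1+κ ← dyadic-bounds m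
         (n≢0⇒n>0 λ m≡0 → <⇒≢ 1≤d (sym (trans d≡ (cong (_* 2 ^ ν₂ d) m≡0)))) =
  AvnLe-mono v n d (^-monoʳ-≤ 2 exponent≤)
    (subst₂ (λ n d → AvnLe v n d (2 ^ (suc κ + length (w ∷ʳ z))))
      (sym (m≡m%n+[m/n]*n n V)) (sym d≡)
      (change v y w z rev m κ (ν₂ d) (n % V) (n / V) odd-m 2^κ≤m m<2^1+κ (m%n<n n V)))
  where
  V = 2 ^ ν₂ d
  instance
    V≢0 : NonZero V
    V≢0 = m^n≢0 2 (ν₂ d)
  -- The leading digit of `d` gives 2^(κ+ν) ≤ d < 2^k.
  κ+ν<k : κ + ν₂ d < k
  κ+ν<k = ≰⇒> λ k≤ → <⇒≱ d<2^k (≤-trans (^-monoʳ-≤ 2 k≤)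
    (subst₂ _≤_ (sym (^-distribˡ-+-* 2 κ (ν₂ d))) (sym d≡) (*-monoˡ-≤ V 2^κ≤m)))
  ∣v∣ : length v ≡ suc (length (w ∷ʳ z))
  ∣v∣ = trans (sym (length-reverse v)) (cong length rev)
  -- The bound obtained is 2^(κ+|v|), and `κ` is at most k - ν - 1.
  exponent≤ : suc κ + length (w ∷ʳ z) ≤ k + length v ∸ ν₂ d ∸ 1
  exponent≤ = subst (suc κ + length (w ∷ʳ z) ≤_) (sym (∸-+-assoc (k + length v) (ν₂ d) 1))
    (m+n≤o⇒m≤o∸n (suc κ + length (w ∷ʳ z)) (begin
      suc κ + length (w ∷ʳ z) + (ν₂ d + 1)        ≡⟨ regroup κ (length (w ∷ʳ z)) (ν₂ d) ⟩
      suc (κ + ν₂ d) + suc (length (w ∷ʳ z))      ≤⟨ +-mono-≤ κ+ν<k (≤-reflexive (sym ∣v∣)) ⟩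
      k + length v                                ∎))
    where
    open ≤-Reasoning
    regroup : ∀ κ p ν → suc κ + p + (ν + 1) ≡ suc (κ + ν) + suc p
    regroup = solve-∀
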